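{- Let $\mathcal{C}$ be a finitely complete category that has coequalizers and in which regular epimorphisms are closed under composition, let $H\colon\mathcal{C}\to\mathcal{C}$ be a functor preserving monomorphisms, and let $(X,\xi)$ be an $H$-coalgebra. If the $\mathsf{select}$ routine is progressing, then the categorical partition refinement algorithm (described in the context) terminates and computes the simple quotient of the input coalgebra $(X,\xi)$, provided that $(X,\xi)$ has only finitely many quotients.
   Context: The kernel $\ker f$ of $f\colon X\to Y$ is its kernel pair $\ker f\rightrightarrows X$, regarded as a subobject of $X\times X$. For a kernel $R\rightrightarrows X$, $\kappa_R\colon X\twoheadrightarrow X/R$ is its coequalizer. $R$ is finer than $R'$ if $R\le R'$ as subobjects of $X\times X$; $\cap$ is intersection of subobjects. A coalgebra is a pair $(X,\xi)$ with $\xi\colon X\to HX$; a coalgebra morphism $h\colon(X,\xi)\to(Y,\zeta)$ is a morphism with $\zeta\cdot h=Hh\cdot\xi$. A quotient of a coalgebra $(X,\xi)$ is represented by a coalgebra morphism with domain $(X,\xi)$ carried by a regular epimorphism of $\mathcal{C}$ (up to isomorphism of codomains under $X$); a coalgebra is simple if every quotient of it is an isomorphism; the simple quotient of a coalgebra is a quotient with simple codomain (unique up to isomorphism). A $\mathsf{select}$ routine is an operation that receives a chain of regular epimorphisms $X\xrightarrow{y}Y\xrightarrow{z}Z$ and returns some morphism $\mathsf{select}(y,z)\colon Y\to K$. It is discarding at $(y,z)$ if $\mathsf{select}(y,z)$ factorizes through $z$; it is progressing if it is discarding at $(y,z)$ only if $z$ is an isomorphism. Algorithm (categorical partition refinement),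 for a fixed $\mathsf{select}$ routine: given $\xi\colon X\to HX$, put $Q_0=X\times X$, $\bar q_0=\,!\colon X\to 1=K_0$ (with $1$ the terminal object), $P_0=\ker(X\xrightarrow{\xi}HX\xrightarrow{H!}H1)$. Then iterate for $i=0,1,2,\dots$ while $P_i$ is properly finer than $Q_i$: (1) $q_{i+1}=\mathsf{select}(\kappa_{P_i},f_i)\cdot\kappa_{P_i}\colon X\to K_{i+1}$, where $f_i\colon X/P_i\twoheadrightarrow X/Q_i$ is the unique morphism with $f_i\cdot\kappa_{P_i}=\kappa_{Q_i}$ (it exists because $P_i$ is always finer than $Q_i$), and $\bar q_{i+1}=\langle\bar q_i,q_{i+1}\rangle\colon X\to\prod_{j\le i+1}K_j$; (2) $Q_{i+1}=\ker\bar q_{i+1}=Q_i\cap\ker q_{i+1}$; (3) $P_{i+1}=\ker(X\xrightarrow{\xi}HX\xrightarrow{H\bar q_{i+1}}H\prod_{j\le i+1}K_j)$. Upon termination (i.e. when $P_i=Q_i$) return $X/P_i=X/Q_i$. If $P_i=Q_i$, then $X/Q_i$ carries a unique coalgebra structure making $\kappa_{Q_i}$ a coalgebra morphism; computing the simple quotient means that $\kappa_{Q_i}$ with this structure represents the simple quotient of $(X,\xi)$.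
   Formalization: "Finitely many quotients" is required of the carrier X in C (all regular epis out of X), not just of coalgebra quotients of (X,ξ); counting only the latter the claim fails, e.g. for an infinite simple coalgebra on ℕ for H = 2×(−) in Set with select(y,z) = id. -}

module Defs where

open import Level using (Level; _⊔_) renaming (suc to lsuc)
open import Data.Nat using (ℕ; zero; suc; _<_)
open import Data.Fin using (Fin)
open import Data.Product using (Σ; ∃; _×_; _,_; proj₁; proj₂)
open import Function.Bundles using (Bijection)
open import Relation.Nullary using (¬_)
open import Relation.Binary.Core using (Rel)
open import Relation.Binary.Bundles using (Setoid)
open import Relation.Binary.Structures using (IsEquivalence)
import Relation.Binary.PropositionalEquality as ≡
import Relation.Binary.Reasoning.Setoid as SetoidReasoning

-- Equality of morphisms is an equivalence relation on each hom-type; objects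
-- are never compared for equality.
record Category (o ℓ e : Level) : Set (lsuc (o ⊔ ℓ ⊔ e)) where
  infix  4 _≈_ _⇒_
  infixr 9 _∘_
  field
    Obj       : Set o
    _⇒_       : Rel Obj ℓ
    _≈_       : ∀ {A B} → Rel (A ⇒ B) e
    id        : ∀ {A} → A ⇒ A
    _∘_       : ∀ {A B C} → B ⇒ C → A ⇒ B → A ⇒ C
    assoc     : ∀ {A B C D} {f : A ⇒ B} {g : B ⇒ C} {h : C ⇒ D} →
                (h ∘ g) ∘ f ≈ h ∘ (g ∘ f)
    identityˡ : ∀ {A B} {f : A ⇒ B} → id ∘ f ≈ f
    identityʳ : ∀ {A B} {f : A ⇒ B} → f ∘ id ≈ f
    equiv     : ∀ {A B} → IsEquivalence (_≈_ {A} {B})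
    ∘-resp-≈  : ∀ {A B C} {f f′ : B ⇒ C} {g g′ : A ⇒ B} →
                f ≈ f′ → g ≈ g′ → f ∘ g ≈ f′ ∘ g′

  module Equiv {A B : Obj} = IsEquivalence (equiv {A} {B})

  homSetoid : Obj → Obj → Setoid ℓ e
  homSetoid A B = record { Carrier = A ⇒ B ; _≈_ = _≈_ ; isEquivalence = equiv }

  module HomReasoning {A B : Obj} = SetoidReasoning (homSetoid A B)

  ∘-resp-≈ˡ : ∀ {A B C} {f f′ : B ⇒ C} {g : A ⇒ B} → f ≈ f′ → f ∘ g ≈ f′ ∘ g
  ∘-resp-≈ˡ p = ∘-resp-≈ p Equiv.refl

  ∘-resp-≈ʳ : ∀ {A B C} {f : B ⇒ C} {g g′ : A ⇒ B} → g ≈ g′ → f ∘ g ≈ f ∘ g′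
  ∘-resp-≈ʳ p = ∘-resp-≈ Equiv.refl p

module _ {o ℓ e : Level} (C : Category o ℓ e) where
  open Category C

  Mono : ∀ {A B} → A ⇒ B → Set (o ⊔ ℓ ⊔ e)
  Mono {A} m = ∀ {Z} (g h : Z ⇒ A) → m ∘ g ≈ m ∘ h → g ≈ h

  record IsIso {A B} (f : A ⇒ B) : Set (ℓ ⊔ e) where
    field
      inv  : B ⇒ A
      isoˡ : inv ∘ f ≈ id
      isoʳ : f ∘ inv ≈ id

  record Terminal : Set (o ⊔ ℓ ⊔ e) where
    field
      ⊤        : Obj
      !        : ∀ {A} → A ⇒ ⊤
      !-unique : ∀ {A} (f : A ⇒ ⊤) → ! ≈ f

  record Product (A B : Obj) : Set (o ⊔ ℓ ⊔ e) where
    field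
      A×B      : Obj
      π₁       : A×B ⇒ A
      π₂       : A×B ⇒ B
      ⟨_,_⟩    : ∀ {Z} → Z ⇒ A → Z ⇒ B → Z ⇒ A×B
      project₁ : ∀ {Z} {f : Z ⇒ A} {g : Z ⇒ B} → π₁ ∘ ⟨ f , g ⟩ ≈ f
      project₂ : ∀ {Z} {f : Z ⇒ A} {g : Z ⇒ B} → π₂ ∘ ⟨ f , g ⟩ ≈ g
      unique   : ∀ {Z} {h : Z ⇒ A×B} {f : Z ⇒ A} {g : Z ⇒ B} →
                 π₁ ∘ h ≈ f → π₂ ∘ h ≈ g → ⟨ f , g ⟩ ≈ h

  record Equalizer {A B} (f g : A ⇒ B) : Set (o ⊔ ℓ ⊔ e) where
    field
      obj       : Obj
      arr       : obj ⇒ A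
      equality  : f ∘ arr ≈ g ∘ arr
      equalize  : ∀ {Z} {h : Z ⇒ A} → f ∘ h ≈ g ∘ h → Z ⇒ obj
      universal : ∀ {Z} {h : Z ⇒ A} {eq : f ∘ h ≈ g ∘ h} → h ≈ arr ∘ equalize eq
      unique    : ∀ {Z} {h : Z ⇒ A} {i : Z ⇒ obj} {eq : f ∘ h ≈ g ∘ h} →
                  h ≈ arr ∘ i → i ≈ equalize eq

  record FinitelyComplete : Set (o ⊔ ℓ ⊔ e) where
    field
      terminal  : Terminal
      product   : ∀ A B → Product A B
      equalizer : ∀ {A B} (f g : A ⇒ B) → Equalizer f g

  record IsCoequalizer {A B D} (f g : A ⇒ B) (q : B ⇒ D) : Set (o ⊔ ℓ ⊔ e) where
    field
      equality   : q ∘ f ≈ q ∘ g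
      coequalize : ∀ {Z} {h : B ⇒ Z} → h ∘ f ≈ h ∘ g → D ⇒ Z
      universal  : ∀ {Z} {h : B ⇒ Z} {eq : h ∘ f ≈ h ∘ g} → h ≈ coequalize eq ∘ q
      unique     : ∀ {Z} {h : B ⇒ Z} {i : D ⇒ Z} {eq : h ∘ f ≈ h ∘ g} →
                   h ≈ i ∘ q → i ≈ coequalize eq

  record Coequalizer {A B} (f g : A ⇒ B) : Set (o ⊔ ℓ ⊔ e) where
    field
      obj           : Obj
      arr           : B ⇒ obj
      isCoequalizer : IsCoequalizer f g arr

    open IsCoequalizer isCoequalizer public

  HasCoequalizers : Set (o ⊔ ℓ ⊔ e)
  HasCoequalizers = ∀ {A B} (f g : A ⇒ B) → Coequalizer f g

  record RegularEpi {A B} (q : A ⇒ B) : Set (o ⊔ ℓ ⊔ e) where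
    field
      {dom}         : Obj
      l r           : dom ⇒ A
      isCoequalizer : IsCoequalizer l r q

  RegularEpisComposable : Set (o ⊔ ℓ ⊔ e)
  RegularEpisComposable = ∀ {A B D} {g : B ⇒ D} {f : A ⇒ B} →
    RegularEpi g → RegularEpi f → RegularEpi (g ∘ f)

  record Subobject (A : Obj) : Set (o ⊔ ℓ ⊔ e) where
    field
      {dom} : Obj
      arr   : dom ⇒ A
      mono  : Mono arr

  infix 4 _≤ˢ_ _≈ˢ_ _<ˢ_

  _≤ˢ_ : ∀ {A} → Rel (Subobject A) (ℓ ⊔ e)
  R ≤ˢ S = ∃ λ h → Subobject.arr S ∘ h ≈ Subobject.arr R

  _≈ˢ_ : ∀ {A} → Rel (Subobject A) (ℓ ⊔ e)
  R ≈ˢ S = R ≤ˢ S × S ≤ˢ R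

  _<ˢ_ : ∀ {A} → Rel (Subobject A) (ℓ ⊔ e)
  R <ˢ S = R ≤ˢ S × ¬ (S ≤ˢ R)

  ≤ˢ-trans : ∀ {A} {R S T : Subobject A} → R ≤ˢ S → S ≤ˢ T → R ≤ˢ T
  ≤ˢ-trans (h , p) (k , q) =
    k ∘ h , Equiv.trans (Equiv.sym assoc) (Equiv.trans (∘-resp-≈ˡ q) p)

  full : ∀ A → Subobject A
  full A = record
    { arr  = id
    ; mono = λ g h p → Equiv.trans (Equiv.sym identityˡ) (Equiv.trans p identityˡ)
    }

  record Quotient (X : Obj) : Set (o ⊔ ℓ ⊔ e) where
    field
      {cod}      : Obj
      arr        : X ⇒ cod
      regularEpi : RegularEpi arr

  _≅Q_ : ∀ {X} → Rel (Quotient X) (ℓ ⊔ e)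
  q ≅Q q′ = Σ (Quotient.cod q ⇒ Quotient.cod q′) λ φ →
    IsIso φ × φ ∘ Quotient.arr q ≈ Quotient.arr q′

  ≅Q-isEquivalence : ∀ {X} → IsEquivalence (_≅Q_ {X})
  ≅Q-isEquivalence = record
    { refl  = id , record { inv = id ; isoˡ = identityˡ ; isoʳ = identityˡ } , identityˡ
    ; sym   = λ (φ , i , p) →
        inv i , record { inv = φ ; isoˡ = isoʳ i ; isoʳ = isoˡ i }
              , Equiv.trans (∘-resp-≈ʳ (Equiv.sym p)) (cancel (isoˡ i))
    ; trans = λ (φ , i , p) (ψ , j , q) →
        ψ ∘ φ
      , record { inv  = inv i ∘ inv j
               ; isoˡ = Equiv.trans assoc (Equiv.trans (∘-resp-≈ʳ (cancel (isoˡ j))) (isoˡ i))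
               ; isoʳ = Equiv.trans assoc (Equiv.trans (∘-resp-≈ʳ (cancel (isoʳ i))) (isoʳ j)) }
      , Equiv.trans assoc (Equiv.trans (∘-resp-≈ʳ p) q)
    }
    where
    open IsIso
    cancel : ∀ {A B D} {f : A ⇒ B} {g : B ⇒ A} {h : D ⇒ A} →
             g ∘ f ≈ id → g ∘ (f ∘ h) ≈ h
    cancel p = Equiv.trans (Equiv.sym assoc) (Equiv.trans (∘-resp-≈ˡ p) identityˡ)

  quotientSetoid : Obj → Setoid (o ⊔ ℓ ⊔ e) (ℓ ⊔ e)
  quotientSetoid X = record
    { Carrier = Quotient X ; _≈_ = _≅Q_ ; isEquivalence = ≅Q-isEquivalence }

  -- Quotients of the object X in C.  For a coalgebra (X , ξ) this counts all
  -- regular epis out of the carrier, not just those that are coalgebra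
  -- morphisms: the algorithm passes through quotients X/Pᵢ and X/Qᵢ that carry
  -- no coalgebra structure, and it may run forever on an infinite simple
  -- coalgebra.
  FinitelyManyQuotients : Obj → Set (o ⊔ ℓ ⊔ e)
  FinitelyManyQuotients X =
    ∃ λ n → Bijection (≡.setoid (Fin n)) (quotientSetoid X)

  -- K may depend on the chain.  Compatibility with ≈ is not required, nor is
  -- independence of the way in which y and z are exhibited as regular epis.
  Select : Set (o ⊔ ℓ ⊔ e)
  Select = ∀ {X Y Z} (y : X ⇒ Y) (z : Y ⇒ Z) →
    RegularEpi y → RegularEpi z → Σ Obj (λ K → Y ⇒ K)

  DiscardingAt : Select → ∀ {X Y Z} (y : X ⇒ Y) (z : Y ⇒ Z) →
    RegularEpi y → RegularEpi z → Set (ℓ ⊔ e)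
  DiscardingAt select {Z = Z} y z ry rz =
    let (K , s) = select y z ry rz in Σ (Z ⇒ K) λ g → g ∘ z ≈ s

  Progressing : Select → Set (o ⊔ ℓ ⊔ e)
  Progressing select = ∀ {X Y Z} (y : X ⇒ Y) (z : Y ⇒ Z)
    (ry : RegularEpi y) (rz : RegularEpi z) →
    DiscardingAt select y z ry rz → IsIso z

record Endofunctor {o ℓ e} (C : Category o ℓ e) : Set (o ⊔ ℓ ⊔ e) where
  open Category C
  field
    F₀           : Obj → Obj
    F₁           : ∀ {A B} → A ⇒ B → F₀ A ⇒ F₀ B
    identity     : ∀ {A} → F₁ (id {A}) ≈ id
    homomorphism : ∀ {A B D} {f : A ⇒ B} {g : B ⇒ D} → F₁ (g ∘ f) ≈ F₁ g ∘ F₁ f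
    F-resp-≈     : ∀ {A B} {f g : A ⇒ B} → f ≈ g → F₁ f ≈ F₁ g

PreservesMonos : ∀ {o ℓ e} {C : Category o ℓ e} → Endofunctor C → Set (o ⊔ ℓ ⊔ e)
PreservesMonos {C = C} H = ∀ {A B} {m : A ⇒ B} → Mono C m → Mono C (F₁ m)
  where
  open Category C
  open Endofunctor H

module _ {o ℓ e : Level} {C : Category o ℓ e} (H : Endofunctor C) where
  open Category C
  open Endofunctor H

  record Coalgebra : Set (o ⊔ ℓ) where
    constructor _,ᶜ_
    field
      carrier   : Obj
      structure : carrier ⇒ F₀ carrier

  record CoalgebraMorphism (𝒳 𝒴 : Coalgebra) : Set (ℓ ⊔ e) where
    private
      module 𝒳 = Coalgebra 𝒳
      module 𝒴 = Coalgebra 𝒴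
    field
      hom      : 𝒳.carrier ⇒ 𝒴.carrier
      commutes : 𝒴.structure ∘ hom ≈ F₁ hom ∘ 𝒳.structure

  open CoalgebraMorphism

  Coalg : Category (o ⊔ ℓ) (ℓ ⊔ e) e
  Coalg = record
    { Obj       = Coalgebra
    ; _⇒_       = CoalgebraMorphism
    ; _≈_       = λ f g → hom f ≈ hom g
    ; id        = record
        { hom      = id
        ; commutes = Equiv.trans identityʳ
            (Equiv.trans (Equiv.sym identityˡ) (∘-resp-≈ˡ (Equiv.sym identity))) }
    ; _∘_       = λ g f → record
        { hom      = hom g ∘ hom f
        ; commutes =
            Equiv.trans (Equiv.sym assoc)
            (Equiv.trans (∘-resp-≈ˡ (commutes g))
            (Equiv.trans assoc
            (Equiv.trans (∘-resp-≈ʳ (commutes f))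
            (Equiv.trans (Equiv.sym assoc)
            (∘-resp-≈ˡ (Equiv.sym homomorphism)))))) }
    ; assoc     = assoc
    ; identityˡ = identityˡ
    ; identityʳ = identityʳ
    ; equiv     = record { refl = Equiv.refl ; sym = Equiv.sym ; trans = Equiv.trans }
    ; ∘-resp-≈  = ∘-resp-≈
    }

  IsCoalgebraQuotient : ∀ {𝒳 𝒴} → CoalgebraMorphism 𝒳 𝒴 → Set (o ⊔ ℓ ⊔ e)
  IsCoalgebraQuotient h = RegularEpi C (hom h)

  Simple : Coalgebra → Set (o ⊔ ℓ ⊔ e)
  Simple 𝒳 = ∀ {𝒴} (h : CoalgebraMorphism 𝒳 𝒴) → IsCoalgebraQuotient h → IsIso Coalg h

  IsSimpleQuotient : ∀ {𝒳 𝒴} → CoalgebraMorphism 𝒳 𝒴 → Set (o ⊔ ℓ ⊔ e)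
  IsSimpleQuotient {𝒴 = 𝒴} h = IsCoalgebraQuotient h × Simple 𝒴

module Kernels {o ℓ e : Level} {C : Category o ℓ e}
  (fc : FinitelyComplete C) (coeq : HasCoequalizers C) where

  open Category C
  open FinitelyComplete fc

  module ⊗ (A B : Obj) = Product (product A B)

  _⊗_ : Obj → Obj → Obj
  A ⊗ B = ⊗.A×B A B

  ⟪_,_⟫ : ∀ {Z A B} → Z ⇒ A → Z ⇒ B → Z ⇒ A ⊗ B
  ⟪_,_⟫ {A = A} {B} = ⊗.⟨_,_⟩ A B

  ker : ∀ {X Y} → X ⇒ Y → Subobject C (X ⊗ X)
  ker {X} f = record { arr = E.arr ; mono = mono }
    where
    module E = Equalizer (equalizer (f ∘ ⊗.π₁ X X) (f ∘ ⊗.π₂ X X))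
    mono : Mono C E.arr
    mono g h p = Equiv.trans (E.unique {eq = eq} Equiv.refl) (Equiv.sym (E.unique p))
      where
      eq : (f ∘ ⊗.π₁ X X) ∘ (E.arr ∘ g) ≈ (f ∘ ⊗.π₂ X X) ∘ (E.arr ∘ g)
      eq = Equiv.trans (Equiv.sym assoc) (Equiv.trans (∘-resp-≈ˡ E.equality) assoc)

  module _ {X : Obj} (R : Subobject C (X ⊗ X)) where
    private module R = Subobject R

    leg₁ leg₂ : R.dom ⇒ X
    leg₁ = ⊗.π₁ X X ∘ R.arr
    leg₂ = ⊗.π₂ X X ∘ R.arr

    module Coeq = Coequalizer (coeq leg₁ leg₂)

    X/ : Obj
    X/ = Coeq.obj

    κ : X ⇒ X/
    κ = Coeq.arr

    κ-regularEpi : RegularEpi C κ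
    κ-regularEpi = record { l = leg₁ ; r = leg₂ ; isCoequalizer = Coeq.isCoequalizer }

    Identifies : ∀ {Z} → X ⇒ Z → Set e
    Identifies h = h ∘ leg₁ ≈ h ∘ leg₂

    κ-epi : ∀ {Z} {g h : X/ ⇒ Z} → g ∘ κ ≈ h ∘ κ → g ≈ h
    κ-epi {g = g} {h} p =
      Equiv.trans (Coeq.unique {eq = eq} Equiv.refl) (Equiv.sym (Coeq.unique p))
      where
      eq : (g ∘ κ) ∘ leg₁ ≈ (g ∘ κ) ∘ leg₂
      eq = Equiv.trans assoc (Equiv.trans (∘-resp-≈ʳ Coeq.equality) (Equiv.sym assoc))

  module _ {X : Obj} where
    π₁′ π₂′ : X ⊗ X ⇒ X
    π₁′ = ⊗.π₁ X X
    π₂′ = ⊗.π₂ X X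

    identifies-mono : ∀ {R S : Subobject C (X ⊗ X)} → _≤ˢ_ C R S →
      ∀ {Z} {h : X ⇒ Z} → Identifies S h → Identifies R h
    identifies-mono {R} {S} (k , p) {h = h} eq = begin
      h ∘ (π₁′ ∘ R.arr)        ≈⟨ ∘-resp-≈ʳ (∘-resp-≈ʳ p) ⟨
      h ∘ (π₁′ ∘ (S.arr ∘ k))  ≈⟨ ∘-resp-≈ʳ assoc ⟨
      h ∘ ((π₁′ ∘ S.arr) ∘ k)  ≈⟨ assoc ⟨
      (h ∘ (π₁′ ∘ S.arr)) ∘ k  ≈⟨ ∘-resp-≈ˡ eq ⟩
      (h ∘ (π₂′ ∘ S.arr)) ∘ k  ≈⟨ assoc ⟩
      h ∘ ((π₂′ ∘ S.arr) ∘ k)  ≈⟨ ∘-resp-≈ʳ assoc ⟩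
      h ∘ (π₂′ ∘ (S.arr ∘ k))  ≈⟨ ∘-resp-≈ʳ (∘-resp-≈ʳ p) ⟩
      h ∘ (π₂′ ∘ R.arr)        ∎
      where
      open HomReasoning
      module R = Subobject R
      module S = Subobject S

    ≤ker : ∀ {R : Subobject C (X ⊗ X)} {Z} {h : X ⇒ Z} →
      Identifies R h → _≤ˢ_ C R (ker h)
    ≤ker {R} {h = h} eq = E.equalize eq′ , Equiv.sym E.universal
      where
      module E = Equalizer (equalizer (h ∘ π₁′) (h ∘ π₂′))
      eq′ : (h ∘ π₁′) ∘ Subobject.arr R ≈ (h ∘ π₂′) ∘ Subobject.arr R
      eq′ = Equiv.trans assoc (Equiv.trans eq (Equiv.sym assoc))

    ker-identifies : ∀ {Z} (h : X ⇒ Z) → Identifies (ker h) h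
    ker-identifies h =
      Equiv.trans (Equiv.sym assoc) (Equiv.trans E.equality assoc)
      where
      module E = Equalizer (equalizer (h ∘ π₁′) (h ∘ π₂′))

    identifies-∘ : ∀ {R : Subobject C (X ⊗ X)} {Y Z} (g : Y ⇒ Z) {h : X ⇒ Y} →
      Identifies R h → Identifies R (g ∘ h)
    identifies-∘ g eq = Equiv.trans assoc (Equiv.trans (∘-resp-≈ʳ eq) (Equiv.sym assoc))

    module _ {R S : Subobject C (X ⊗ X)} (R≤S : _≤ˢ_ C R S) where
      comparison : X/ R ⇒ X/ S
      comparison = Coeq.coequalize R (identifies-mono {R} {S} R≤S (Coeq.equality S))

      comparison-κ : comparison ∘ κ R ≈ κ S
      comparison-κ = Equiv.sym (Coeq.universal R)

      comparison-regularEpi : RegularEpi C comparison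
      comparison-regularEpi = record
        { l = κ R ∘ leg₁ S
        ; r = κ R ∘ leg₂ S
        ; isCoequalizer = record
          { equality   = Equiv.trans (Equiv.sym assoc)
                           (Equiv.trans (∘-resp-≈ˡ comparison-κ)
                           (Equiv.trans (Coeq.equality S)
                           (Equiv.trans (∘-resp-≈ˡ (Equiv.sym comparison-κ)) assoc)))
          ; coequalize = λ eq → Coeq.coequalize S (shift eq)
          ; universal  = λ {_} {h} {eq} → κ-epi R
                           (Equiv.trans (Coeq.universal S {eq = shift eq})
                           (Equiv.trans (∘-resp-≈ʳ (Equiv.sym comparison-κ))
                           (Equiv.sym assoc)))
          ; unique     = λ p → Coeq.unique S
                           (Equiv.trans (∘-resp-≈ˡ p)
                           (Equiv.trans assoc (∘-resp-≈ʳ comparison-κ)))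
          }
        }
        where
        shift : ∀ {Z} {h : X/ R ⇒ Z} → h ∘ (κ R ∘ leg₁ S) ≈ h ∘ (κ R ∘ leg₂ S) →
                Identifies S (h ∘ κ R)
        shift eq = Equiv.trans assoc (Equiv.trans eq (Equiv.sym assoc))

module PartitionRefinement {o ℓ e : Level} {C : Category o ℓ e}
  (fc : FinitelyComplete C) (coeq : HasCoequalizers C)
  (H : Endofunctor C) (select : Select C) (𝒳 : Coalgebra H) where

  open Category C
  open FinitelyComplete fc using (terminal)
  open Terminal terminal using (⊤; !)
  open Endofunctor H
  open Coalgebra 𝒳 renaming (carrier to X; structure to ξ)
  open Kernels fc coeq

  infix 4 _≤_ _<ₛ_ _≈ₛ_
  _≤_ _<ₛ_ _≈ₛ_ : Rel (Subobject C (X ⊗ X)) (ℓ ⊔ e)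
  _≤_  = _≤ˢ_ C
  _<ₛ_ = _<ˢ_ C
  _≈ₛ_ = _≈ˢ_ C

  -- ∏K is the left-nested product (⋯(K₀ × K₁) × ⋯) × Kᵢ with K₀ = 1.  The last two fields are
  -- invariants; P≤Q is what makes the morphism f : X/P → X/Q available.
  record State : Set (o ⊔ ℓ ⊔ e) where
    field
      {∏K} : Obj
      q̄    : X ⇒ ∏K
      Q    : Subobject C (X ⊗ X)

    P : Subobject C (X ⊗ X)
    P = ker (F₁ q̄ ∘ ξ)

    field
      Q≤ker : Q ≤ ker q̄
      P≤Q   : P ≤ Q

    f : X/ P ⇒ X/ Q
    f = comparison {R = P} {S = Q} P≤Q

    f-regularEpi : RegularEpi C f
    f-regularEpi = comparison-regularEpi {R = P} {S = Q} P≤Q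

  initial : State
  initial = record
    { q̄     = !
    ; Q     = full C (X ⊗ X)
    ; Q≤ker = ≤ker {R = full C (X ⊗ X)}
        (Equiv.trans (Equiv.sym (Terminal.!-unique terminal _)) (Terminal.!-unique terminal _))
    ; P≤Q   = Subobject.arr (ker (F₁ ! ∘ ξ)) , identityˡ
    }

  module Step (s : State) where
    open State s

    K′ : Obj
    K′ = proj₁ (select (κ P) f (κ-regularEpi P) f-regularEpi)

    q′ : X ⇒ K′
    q′ = proj₂ (select (κ P) f (κ-regularEpi P) f-regularEpi) ∘ κ P

    q̄′ : X ⇒ ∏K ⊗ K′
    q̄′ = ⟪ q̄ , q′ ⟫

    private
      module ⊗K = ⊗ ∏K K′

      pair-identifies : ∀ {R : Subobject C (X ⊗ X)} →
        Identifies R q̄ → Identifies R q′ → Identifies R q̄′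
      pair-identifies {R} a b =
        Equiv.trans (Equiv.sym (⊗K.unique (proj ⊗K.project₁) (proj ⊗K.project₂)))
                    (⊗K.unique (Equiv.trans (proj ⊗K.project₁) (Equiv.sym a))
                               (Equiv.trans (proj ⊗K.project₂) (Equiv.sym b)))
        where
        proj : ∀ {A B D E} {g : B ⇒ D} {h : A ⇒ B} {k : A ⇒ D} {l : E ⇒ A} →
               g ∘ h ≈ k → g ∘ (h ∘ l) ≈ k ∘ l
        proj p = Equiv.trans (Equiv.sym assoc) (∘-resp-≈ˡ p)

      P′ : Subobject C (X ⊗ X)
      P′ = ker (F₁ q̄′ ∘ ξ)

      P′≤P : P′ ≤ P
      P′≤P = ≤ker {R = P′} (Equiv.trans (∘-resp-≈ˡ (Equiv.sym split))
               (Equiv.trans (identifies-∘ {R = P′} (F₁ ⊗K.π₁) (ker-identifies (F₁ q̄′ ∘ ξ)))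
               (∘-resp-≈ˡ split)))
        where
        split : F₁ ⊗K.π₁ ∘ (F₁ q̄′ ∘ ξ) ≈ F₁ q̄ ∘ ξ
        split = Equiv.trans (Equiv.sym assoc)
                  (∘-resp-≈ˡ (Equiv.trans (Equiv.sym homomorphism) (F-resp-≈ ⊗K.project₁)))

      P≤Q′ : P ≤ ker q̄′
      P≤Q′ = ≤ker {R = P} (pair-identifies {R = P}
        (identifies-mono {R = P} {S = ker q̄}
          (≤ˢ-trans C {R = P} {S = Q} {T = ker q̄} P≤Q Q≤ker) (ker-identifies q̄))
        (identifies-∘ {R = P} _ (Coeq.equality P)))

    next : State
    next = record
      { q̄     = q̄′
      ; Q     = ker q̄′
      ; Q≤ker = id , identityʳ
      ; P≤Q   = ≤ˢ-trans C {R = P′} {S = P} {T = ker q̄′} P′≤P P≤Q′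
      }

  -- The iteration is continued past the point where the loop exits.
  state : ℕ → State
  state zero    = initial
  state (suc i) = Step.next (state i)

  module At (i : ℕ) = State (state i)

  P Q : ℕ → Subobject C (X ⊗ X)
  P i = At.P i
  Q i = At.Q i

  TerminatesAt : ℕ → Set (ℓ ⊔ e)
  TerminatesAt i = (∀ j → j < i → P j <ₛ Q j) × P i ≈ₛ Q i

  record ComputesSimpleQuotientAt (i : ℕ) : Set (o ⊔ ℓ ⊔ e) where
    field
      ζ        : X/ (Q i) ⇒ F₀ (X/ (Q i))
      ζ-κ      : ζ ∘ κ (Q i) ≈ F₁ (κ (Q i)) ∘ ξ
      ζ-unique : ∀ (ζ′ : X/ (Q i) ⇒ F₀ (X/ (Q i))) →
                 ζ′ ∘ κ (Q i) ≈ F₁ (κ (Q i)) ∘ ξ → ζ′ ≈ ζ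

    κ-morphism : CoalgebraMorphism H 𝒳 (X/ (Q i) ,ᶜ ζ)
    κ-morphism = record { hom = κ (Q i) ; commutes = ζ-κ }

    field
      isSimpleQuotient : IsSimpleQuotient H κ-morphism

{-# OPTIONS --safe #-}
-- Isomorphism of quotients of X is decidable because there are finitely many,
-- hence so is the loop condition.  By the pigeonhole principle X/Qᵢ ≅ X/Qⱼ for
-- some i < j, so Qᵢ ≤ ker qᵢ₊₁; then select discards at (κ_Pᵢ , fᵢ), and progress
-- makes fᵢ an isomorphism, i.e. Pᵢ = Qᵢ.  At that point q̄ᵢ = m ∘ κ_Qᵢ with m monic,
-- and since H m is monic too, H κ_Qᵢ ∘ ξ identifies Qᵢ = Pᵢ, which yields the
-- coalgebra structure.  Every coalgebra quotient k of (X , ξ) satisfies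
-- ker k ≤ Qᵢ for all i, so X/Qᵢ admits no proper quotient.
module Submission where

open import Data.Fin using (Fin; toℕ)
open import Data.Fin.Properties using (pigeonhole) renaming (_≟_ to _≟ᶠ_)
open import Data.Nat using (ℕ; zero; suc; _<_; s<s; _≤′_; ≤′-refl; ≤′-step)
open import Data.Nat.Properties using (n<1+n; ≤⇒≤′)
open import Data.Product using (Σ; ∃; _×_; _,_; proj₁; proj₂)
open import Function.Bundles using (Bijection)
open import Relation.Binary.Bundles using (Setoid)
open import Relation.Binary.Definitions using (Decidable)
import Relation.Binary.PropositionalEquality as ≡
open import Relation.Nullary using (¬_; Dec; yes; no)
open import Relation.Nullary.Decidable using (map′)
import Relation.Unary as Unary
open import Defs

-- Search over the naturals and counting in finite setoids.

least-witness : ∀ {p} {P : ℕ → Set p} → Unary.Decidable P → ∀ n → P n →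
                ∃ λ i → P i × (∀ j → j < i → ¬ P j)
least-witness P? n pₙ with P? 0
least-witness P? n       pₙ | yes p₀ = 0 , p₀ , λ _ ()
least-witness P? zero    p₀ | no ¬p₀ = 0 , p₀ , λ _ ()
least-witness P? (suc n) pₙ | no ¬p₀ with least-witness (λ i → P? (suc i)) n pₙ
... | i , pᵢ , below = suc i , pᵢ , λ { zero _ → ¬p₀ ; (suc j) (s<s j<i) → below j j<i }

module _ {a ℓ} (S : Setoid a ℓ) {n} (bij : Bijection (≡.setoid (Fin n)) S) where
  open Setoid S
  private module B = Bijection bij

  index : Carrier → Fin n
  index x = proj₁ (B.surjective x)

  to-index : ∀ x → B.to (index x) ≈ x
  to-index x = proj₂ (B.surjective x) ≡.refl

  index-cong : ∀ {x y} → x ≈ y → index x ≡.≡ index y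
  index-cong {x} {y} x≈y =
    B.injective (trans (to-index x) (trans x≈y (sym (to-index y))))

  index-injective : ∀ {x y} → index x ≡.≡ index y → x ≈ y
  index-injective {x} {y} eq =
    trans (sym (to-index x)) (trans (B.cong eq) (to-index y))

  ≈-decidable : Decidable _≈_
  ≈-decidable x y = map′ index-injective index-cong (index x ≟ᶠ index y)

  ≈-pigeonhole : (s : ℕ → Carrier) → ∃ λ i → ∃ λ j → i < j × s i ≈ s j
  -- The `n + 1` terms `s 0`, ..., `s n` already outnumber the `n` classes.
  ≈-pigeonhole s with pigeonhole (n<1+n n) (λ i → index (s (toℕ i)))
  ... | i , j , i<j , eq = toℕ i , toℕ j , i<j , index-injective eq

-- Kernels and factorization through regular epimorphisms.

module Factorization {o ℓ e} {C : Category o ℓ e}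
  (fc : FinitelyComplete C) (coeq : HasCoequalizers C) where

  open Category C
  open FinitelyComplete fc
  open Kernels fc coeq
  open HomReasoning

  regularEpi-epi : ∀ {A B Z} {q : A ⇒ B} → RegularEpi C q →
    {g h : B ⇒ Z} → g ∘ q ≈ h ∘ q → g ≈ h
  regularEpi-epi {q = q} rq {g} {h} p =
    Equiv.trans (Q.unique {eq = eq} Equiv.refl) (Equiv.sym (Q.unique p))
    where
    module Q = IsCoequalizer (RegularEpi.isCoequalizer rq)
    eq = Equiv.trans assoc (Equiv.trans (∘-resp-≈ʳ Q.equality) (Equiv.sym assoc))

  regularEpi-splitMono⇒IsIso : ∀ {A B} {q : A ⇒ B} {u : B ⇒ A} →
    RegularEpi C q → u ∘ q ≈ id → IsIso C q
  regularEpi-splitMono⇒IsIso {q = q} {u} rq uq = record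
    { inv  = u
    ; isoˡ = uq
    ; isoʳ = regularEpi-epi rq (begin
        (q ∘ u) ∘ q  ≈⟨ assoc ⟩
        q ∘ (u ∘ q)  ≈⟨ ∘-resp-≈ʳ uq ⟩
        q ∘ id       ≈⟨ identityʳ ⟩
        q            ≈⟨ identityˡ ⟨
        id ∘ q       ∎)
    }

  module _ {X : Obj} where

    identifies-resp-≈ : (R : Subobject C (X ⊗ X)) → ∀ {Z} {g h : X ⇒ Z} →
      g ≈ h → Identifies R g → Identifies R h
    identifies-resp-≈ R p eq =
      Equiv.trans (∘-resp-≈ˡ (Equiv.sym p)) (Equiv.trans eq (∘-resp-≈ˡ p))

    ≤ker⇒identifies : ∀ {R : Subobject C (X ⊗ X)} {Z} {h : X ⇒ Z} →
      _≤ˢ_ C R (ker h) → Identifies R h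
    ≤ker⇒identifies {R} {h = h} R≤ =
      identifies-mono {R = R} {S = ker h} R≤ (ker-identifies h)

    -- The legs of `ker f` are the universal pair made equal by `f`: any `g`, `h` with
    -- `f ∘ g ≈ f ∘ h` factor jointly through them, so an equation checked on the legs carries over.
    identifies-ker : ∀ {Y Z W} {f : X ⇒ Y} {k : X ⇒ Z} → Identifies (ker f) k →
      {g h : W ⇒ X} → f ∘ g ≈ f ∘ h → k ∘ g ≈ k ∘ h
    identifies-ker {f = f} {k} eq {g} {h} fg≈fh = begin
      k ∘ g                      ≈⟨ ∘-resp-≈ʳ (leg X×X.project₁) ⟨
      k ∘ (leg₁ (ker f) ∘ u)     ≈⟨ assoc ⟨
      (k ∘ leg₁ (ker f)) ∘ u     ≈⟨ ∘-resp-≈ˡ eq ⟩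
      (k ∘ leg₂ (ker f)) ∘ u     ≈⟨ assoc ⟩
      k ∘ (leg₂ (ker f) ∘ u)     ≈⟨ ∘-resp-≈ʳ (leg X×X.project₂) ⟩
      k ∘ h                      ∎
      where
      module X×X = ⊗ X X
      module E = Equalizer (equalizer (f ∘ π₁′ {X}) (f ∘ π₂′ {X}))
      agree : (f ∘ π₁′) ∘ ⟪ g , h ⟫ ≈ (f ∘ π₂′) ∘ ⟪ g , h ⟫
      agree = begin
        (f ∘ π₁′) ∘ ⟪ g , h ⟫  ≈⟨ assoc ⟩
        f ∘ (π₁′ ∘ ⟪ g , h ⟫)  ≈⟨ ∘-resp-≈ʳ X×X.project₁ ⟩
        f ∘ g                  ≈⟨ fg≈fh ⟩
        f ∘ h                  ≈⟨ ∘-resp-≈ʳ X×X.project₂ ⟨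
        f ∘ (π₂′ ∘ ⟪ g , h ⟫)  ≈⟨ assoc ⟨
        (f ∘ π₂′) ∘ ⟪ g , h ⟫  ∎
      u : _ ⇒ E.obj
      u = E.equalize agree
      leg : ∀ {π : X ⊗ X ⇒ X} {l} → π ∘ ⟪ g , h ⟫ ≈ l → (π ∘ E.arr) ∘ u ≈ l
      leg p = Equiv.trans assoc (Equiv.trans (∘-resp-≈ʳ (Equiv.sym E.universal)) p)

    -- The pair that `k` coequalizes may differ from its kernel pair, but it factors through
    -- `ker k`, so `h` makes it equal too.
    regularEpi-factor : ∀ {Y Z} {k : X ⇒ Y} {h : X ⇒ Z} → RegularEpi C k →
      Identifies (ker k) h → Σ (Y ⇒ Z) λ u → h ≈ u ∘ k
    regularEpi-factor {k = k} {h} rk eq =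
      K.coequalize eq′ , K.universal {eq = eq′}
      where
      module K = IsCoequalizer (RegularEpi.isCoequalizer rk)
      eq′ = identifies-ker {f = k} {k = h} eq K.equality

    κ-factor : (R : Subobject C (X ⊗ X)) → ∀ {Z} {h : X ⇒ Z} → Identifies R h →
      Σ (X/ R ⇒ Z) λ u → h ≈ u ∘ κ R
    κ-factor R eq = Coeq.coequalize R eq , Coeq.universal R {eq = eq}

    -- `R` need not be the kernel of `κ R`, so `S` cannot be compared with `R` directly. But `g`
    -- factors through `κ R`, hence identifies whatever `κ R` does. This lets the finite count of
    -- quotients speak about relations.
    κ-identifies⇒≤ker : (S : Subobject C (X ⊗ X)) → ∀ {Z} (g : X ⇒ Z) →
      (R : Subobject C (X ⊗ X)) → _≤ˢ_ C R (ker g) →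
      Identifies S (κ R) → _≤ˢ_ C S (ker g)
    κ-identifies⇒≤ker S g R R≤ eq with κ-factor R (≤ker⇒identifies {R = R} {h = g} R≤)
    ... | u , p = ≤ker {R = S} (identifies-resp-≈ S (Equiv.sym p) (identifies-∘ {R = S} u eq))

    κ-quotient : Subobject C (X ⊗ X) → Quotient C X
    κ-quotient R = record { arr = κ R ; regularEpi = κ-regularEpi R }

    κ-≅⇒≤ker : (S : Subobject C (X ⊗ X)) → ∀ {Z} (g : X ⇒ Z) →
      (R : Subobject C (X ⊗ X)) → _≤ˢ_ C R (ker g) →
      _≅Q_ C (κ-quotient S) (κ-quotient R) → _≤ˢ_ C S (ker g)
    κ-≅⇒≤ker S g R R≤ (φ , _ , p) =
      κ-identifies⇒≤ker S g R R≤
        (identifies-resp-≈ S p (identifies-∘ {R = S} φ (Coeq.equality S)))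

    ≤⇒comparison-iso : {R S : Subobject C (X ⊗ X)} (R≤S : _≤ˢ_ C R S) → _≤ˢ_ C S R →
      IsIso C (comparison {R = R} {S} R≤S)
    ≤⇒comparison-iso {R} {S} R≤S S≤R = record
      { inv  = comparison {R = S} {R} S≤R
      ; isoˡ = κ-epi R (round (comparison-κ {R = R} {S} R≤S) (comparison-κ {R = S} {R} S≤R))
      ; isoʳ = κ-epi S (round (comparison-κ {R = S} {R} S≤R) (comparison-κ {R = R} {S} R≤S))
      }
      where
      round : ∀ {A B} {a : X ⇒ A} {b : X ⇒ B} {g : A ⇒ B} {h : B ⇒ A} →
              g ∘ a ≈ b → h ∘ b ≈ a → (h ∘ g) ∘ a ≈ id ∘ a
      round p q = Equiv.trans assoc (Equiv.trans (∘-resp-≈ʳ p)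
                    (Equiv.trans q (Equiv.sym identityˡ)))

    ≈⇒κ-≅ : {R S : Subobject C (X ⊗ X)} → _≤ˢ_ C R S → _≤ˢ_ C S R →
      _≅Q_ C (κ-quotient R) (κ-quotient S)
    ≈⇒κ-≅ {R} {S} R≤S S≤R =
      comparison {R = R} {S} R≤S , ≤⇒comparison-iso {R} {S} R≤S S≤R , comparison-κ {R = R} {S} R≤S

  -- The coequalizer ε of ker m is split monic: ε ∘ κ R is a regular epi whose
  -- kernel is below ker f, hence below R, so κ R factors through it.
  κ-image-mono : RegularEpisComposable C → ∀ {X} (R : Subobject C (X ⊗ X)) →
    ∀ {Y} {f : X ⇒ Y} {m : X/ R ⇒ Y} →
    _≤ˢ_ C (ker f) R → f ≈ m ∘ κ R → Mono C m
  κ-image-mono composable R {f = f} {m} ker≤R f≈mκ g h mg≈mh = begin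
    g              ≈⟨ cancel ue ⟨
    u ∘ (ε ∘ g)    ≈⟨ ∘-resp-≈ʳ (identifies-ker {f = m} {k = ε} (Coeq.equality (ker m)) mg≈mh) ⟩
    u ∘ (ε ∘ h)    ≈⟨ cancel ue ⟩
    h              ∎
    where
    ε = κ (ker m)
    εκ-regularEpi : RegularEpi C (ε ∘ κ R)
    εκ-regularEpi = composable (κ-regularEpi (ker m)) (κ-regularEpi R)
    n = proj₁ (κ-factor (ker m) (ker-identifies m))
    nεκ≈f : n ∘ (ε ∘ κ R) ≈ f
    nεκ≈f = Equiv.trans (Equiv.sym assoc)
      (Equiv.trans (∘-resp-≈ˡ (Equiv.sym (proj₂ (κ-factor (ker m) (ker-identifies m)))))
        (Equiv.sym f≈mκ))
    S = ker (ε ∘ κ R)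
    S≤ker : _≤ˢ_ C S (ker f)
    S≤ker = ≤ker {R = S}
      (identifies-resp-≈ S nεκ≈f (identifies-∘ {R = S} n (ker-identifies (ε ∘ κ R))))
    factored : Σ _ λ u → κ R ≈ u ∘ (ε ∘ κ R)
    factored = regularEpi-factor εκ-regularEpi
      (identifies-mono {R = S} {S = R} (≤ˢ-trans C {R = S} {S = ker f} {T = R} S≤ker ker≤R)
        (Coeq.equality R))
    u = proj₁ factored
    ue : u ∘ ε ≈ id
    ue = κ-epi R (Equiv.trans assoc
           (Equiv.trans (Equiv.sym (proj₂ factored)) (Equiv.sym identityˡ)))
    cancel : ∀ {A B D} {a : A ⇒ B} {b : B ⇒ A} {d : D ⇒ A} →
             b ∘ a ≈ id → b ∘ (a ∘ d) ≈ d
    cancel p = Equiv.trans (Equiv.sym assoc) (Equiv.trans (∘-resp-≈ˡ p) identityˡ)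

-- The sequences of relations `P i` and `Q i`.

module Refinement {o ℓ e} {C : Category o ℓ e}
  (fc : FinitelyComplete C) (coeq : HasCoequalizers C)
  (H : Endofunctor C) (select : Select C) (𝒳 : Coalgebra H) where

  open Category C
  open FinitelyComplete fc using (terminal)
  open Endofunctor H
  open Coalgebra 𝒳 renaming (carrier to X; structure to ξ)
  open Kernels fc coeq
  open Factorization fc coeq
  open PartitionRefinement fc coeq H select 𝒳 renaming (_≤_ to _⊑_)

  -- Complements the invariant `Q≤ker`, so that `Q i` and `ker (At.q̄ i)` agree. At `0` the relation
  -- is the full one, and afterwards it is this kernel by definition.
  ker-q̄⊑Q : ∀ i → ker (At.q̄ i) ⊑ Q i
  ker-q̄⊑Q zero    = Subobject.arr (ker (At.q̄ zero)) , identityˡ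
  ker-q̄⊑Q (suc i) = id , identityʳ

  -- `At.q̄ j` is a projection of `At.q̄ (suc j)`, so kernels shrink. The order `_≤′_` puts the
  -- induction on the upper index.
  Q-antitone : ∀ {i j} → i ≤′ j → Q j ⊑ Q i
  Q-antitone {i} ≤′-refl = id , identityʳ
  Q-antitone {i} (≤′-step {j} i≤j) =
    ≤ˢ-trans C {R = Q (suc j)} {S = Q j} {T = Q i} step (Q-antitone i≤j)
    where
    module K = ⊗ (At.∏K j) (Step.K′ (state j))
    step : Q (suc j) ⊑ Q j
    step = ≤ˢ-trans C {R = Q (suc j)} {S = ker (At.q̄ j)} {T = Q j}
      (≤ker {R = Q (suc j)} (identifies-resp-≈ (Q (suc j)) K.project₁
        (identifies-∘ {R = Q (suc j)} K.π₁ (ker-identifies (At.q̄ (suc j))))))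
      (ker-q̄⊑Q j)

  -- If `Q i` did not shrink, the new component `q′` identifies it and factors through `κ (Q i)`,
  -- which is `At.f i ∘ κ (P i)`. Cancelling the epi `κ (P i)` leaves a factorization of the
  -- selected morphism through `At.f i`.
  Q-stable⇒discarding : ∀ i → Q i ⊑ Q (suc i) →
    DiscardingAt C select (κ (P i)) (At.f i) (κ-regularEpi (P i)) (At.f-regularEpi i)
  Q-stable⇒discarding i Q⊑Q′ = g , κ-epi (P i) (begin
    (g ∘ At.f i) ∘ κ (P i)  ≈⟨ assoc ⟩
    g ∘ (At.f i ∘ κ (P i))  ≈⟨ ∘-resp-≈ʳ (comparison-κ {R = P i} {Q i} (At.P≤Q i)) ⟩
    g ∘ κ (Q i)             ≈⟨ proj₂ factored ⟨
    q′                      ∎)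
    where
    open HomReasoning
    open Step (state i)
    module K = ⊗ (At.∏K i) K′
    factored : Σ _ λ g → q′ ≈ g ∘ κ (Q i)
    factored = κ-factor (Q i) (identifies-resp-≈ (Q i) K.project₂
      (identifies-∘ {R = Q i} K.π₂
        (≤ker⇒identifies {R = Q i} {h = q̄′} Q⊑Q′)))
    g = proj₁ factored

  κ-≅⇒Q⊑P : ∀ i → _≅Q_ C (κ-quotient (Q i)) (κ-quotient (P i)) → Q i ⊑ P i
  -- `P i` is by definition the kernel of this morphism, so the identity witnesses the inclusion.
  κ-≅⇒Q⊑P i = κ-≅⇒≤ker (Q i) (F₁ (At.q̄ i) ∘ ξ) (P i) (id , identityʳ)

  Q-stable⇒Q⊑P : Progressing C select → ∀ i → Q i ⊑ Q (suc i) → Q i ⊑ P i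
  Q-stable⇒Q⊑P progressing i Q⊑Q′ = κ-≅⇒Q⊑P i
    (Setoid.sym (quotientSetoid C X) {κ-quotient (P i)} {κ-quotient (Q i)}
      ( At.f i
      , progressing _ _ _ _ (Q-stable⇒discarding i Q⊑Q′)
      , comparison-κ {R = P i} {Q i} (At.P≤Q i)))

  -- `Q j` lies below `Q (suc i)`, the kernel of `At.q̄ (suc i)`, so this morphism factors through
  -- `κ (Q j)` and hence through the isomorphic `κ (Q i)`.
  Q-repeats⇒stable : ∀ {i j} → i < j →
    _≅Q_ C (κ-quotient (Q i)) (κ-quotient (Q j)) → Q i ⊑ Q (suc i)
  Q-repeats⇒stable {i} {j} i<j =
    κ-≅⇒≤ker (Q i) (At.q̄ (suc i)) (Q j) (Q-antitone (≤⇒≤′ i<j))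

  -- Termination.

  module _ (finite : FinitelyManyQuotients C X) where

    -- Only quotients are enumerated, not subobjects. As `P i ⊑ Q i` always holds, the reverse
    -- inclusion amounts to an isomorphism of the two quotients.
    Q⊑P? : ∀ i → Dec (Q i ⊑ P i)
    Q⊑P? i = map′ (κ-≅⇒Q⊑P i)
      (λ Q⊑P → ≈⇒κ-≅ {R = Q i} {P i} Q⊑P (At.P≤Q i))
      (≈-decidable (quotientSetoid C X) (proj₂ finite) (κ-quotient (Q i)) (κ-quotient (P i)))

    Q-stabilizes : ∃ λ i → Q i ⊑ Q (suc i)
    Q-stabilizes =
      let i , j , i<j , Qᵢ≅Qⱼ = ≈-pigeonhole (quotientSetoid C X) (proj₂ finite)
                                (λ i → κ-quotient (Q i))
      in i , Q-repeats⇒stable i<j Qᵢ≅Qⱼ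

    terminates : Progressing C select → ∃ TerminatesAt
    terminates progressing =
      let i , Q⊑Q′ = Q-stabilizes
          -- The loop may exit before the index found by pigeonhole; minimality of `j` gives proper
          -- refinement at all earlier indices.
          j , Q⊑P , below = least-witness Q⊑P? i (Q-stable⇒Q⊑P progressing i Q⊑Q′)
      in j , (λ l l<j → At.P≤Q l , below l l<j) , At.P≤Q j , Q⊑P

  -- Coalgebra quotients bound the relations from below.

  module _ {𝒴 : Coalgebra H} (k : CoalgebraMorphism H 𝒳 𝒴) where
    open CoalgebraMorphism k
    open Coalgebra 𝒴 using () renaming (structure to υ)

    -- Since `hom` is a coalgebra morphism, a factorization of `At.q̄ i` through it lifts to one of
    -- `F₁ (At.q̄ i) ∘ ξ`, with second factor `F₁ u ∘ υ`.
    factor⇒ker⊑P : ∀ i {u} → At.q̄ i ≈ u ∘ hom → ker hom ⊑ P i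
    factor⇒ker⊑P i {u} q̄≈u∘k = ≤ker {R = ker hom}
      (identifies-resp-≈ (ker hom) (begin
        (F₁ u ∘ υ) ∘ hom       ≈⟨ assoc ⟩
        F₁ u ∘ (υ ∘ hom)       ≈⟨ ∘-resp-≈ʳ commutes ⟩
        F₁ u ∘ (F₁ hom ∘ ξ)    ≈⟨ assoc ⟨
        (F₁ u ∘ F₁ hom) ∘ ξ    ≈⟨ ∘-resp-≈ˡ homomorphism ⟨
        F₁ (u ∘ hom) ∘ ξ       ≈⟨ ∘-resp-≈ˡ (F-resp-≈ q̄≈u∘k) ⟨
        F₁ (At.q̄ i) ∘ ξ        ∎)
        (identifies-∘ {R = ker hom} (F₁ u ∘ υ) (ker-identifies hom)))
      where open HomReasoning

    -- By induction `ker hom ⊑ P i`. Whatever `select` returns, `q′` passes through `κ (P i)`, so it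
    -- factors through `hom`, and pairing the two factors gives the next one.
    q̄-factors : IsCoalgebraQuotient H k → ∀ i → Σ _ λ u → At.q̄ i ≈ u ∘ hom
    q̄-factors rk zero    = Terminal.! terminal , Terminal.!-unique terminal _
    q̄-factors rk (suc i) = ⟪ u , v ⟫ , K.unique
      (Equiv.trans (Equiv.sym assoc) (Equiv.trans (∘-resp-≈ˡ K.project₁) (Equiv.sym q̄≈u∘k)))
      (Equiv.trans (Equiv.sym assoc) (Equiv.trans (∘-resp-≈ˡ K.project₂) (Equiv.sym q′≈v∘k)))
      where
      open Step (state i)
      module K = ⊗ (At.∏K i) K′
      u = proj₁ (q̄-factors rk i)
      q̄≈u∘k = proj₂ (q̄-factors rk i)
      factored : Σ _ λ v → q′ ≈ v ∘ hom
      factored = regularEpi-factor rk (identifies-∘ {R = ker hom} _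
        (identifies-mono {R = ker hom} {S = P i} (factor⇒ker⊑P i q̄≈u∘k) (Coeq.equality (P i))))
      v = proj₁ factored
      q′≈v∘k = proj₂ factored

    ker⊑Q : IsCoalgebraQuotient H k → ∀ i → ker hom ⊑ Q i
    ker⊑Q rk i = ≤ˢ-trans C {R = ker hom} {S = P i} {T = Q i}
      (factor⇒ker⊑P i (proj₂ (q̄-factors rk i))) (At.P≤Q i)

  isIso-Coalg : ∀ {𝒴 𝒵} (h : CoalgebraMorphism H 𝒴 𝒵) →
    IsIso C (CoalgebraMorphism.hom h) → IsIso (Coalg H) h
  isIso-Coalg {𝒴} {𝒵} h iso = record
    { inv  = record { hom = inv ; commutes = begin
        υ ∘ inv                            ≈⟨ identityˡ ⟨
        id ∘ (υ ∘ inv)                     ≈⟨ ∘-resp-≈ˡ identity ⟨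
        F₁ id ∘ (υ ∘ inv)                  ≈⟨ ∘-resp-≈ˡ (F-resp-≈ isoˡ) ⟨
        F₁ (inv ∘ hom) ∘ (υ ∘ inv)         ≈⟨ ∘-resp-≈ˡ homomorphism ⟩
        (F₁ inv ∘ F₁ hom) ∘ (υ ∘ inv)      ≈⟨ assoc ⟩
        F₁ inv ∘ (F₁ hom ∘ (υ ∘ inv))      ≈⟨ ∘-resp-≈ʳ assoc ⟨
        F₁ inv ∘ ((F₁ hom ∘ υ) ∘ inv)      ≈⟨ ∘-resp-≈ʳ (∘-resp-≈ˡ commutes) ⟨
        F₁ inv ∘ ((ω ∘ hom) ∘ inv)         ≈⟨ ∘-resp-≈ʳ assoc ⟩
        F₁ inv ∘ (ω ∘ (hom ∘ inv))         ≈⟨ ∘-resp-≈ʳ (∘-resp-≈ʳ isoʳ) ⟩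
        F₁ inv ∘ (ω ∘ id)                  ≈⟨ ∘-resp-≈ʳ identityʳ ⟩
        F₁ inv ∘ ω                         ∎ }
    ; isoˡ = isoˡ
    ; isoʳ = isoʳ
    }
    where
    open HomReasoning
    open IsIso iso
    open CoalgebraMorphism h
    υ = Coalgebra.structure 𝒴
    ω = Coalgebra.structure 𝒵

  -- Correctness of the result.

  Q⊑P⇒computesSimpleQuotient : RegularEpisComposable C → PreservesMonos H →
    ∀ i → Q i ⊑ P i → ComputesSimpleQuotientAt i
  Q⊑P⇒computesSimpleQuotient composable preserves i Q⊑P = record
    { ζ                = ζ
    ; ζ-κ              = ζ-κ
    ; ζ-unique         = λ ζ′ p → κ-epi (Q i) (Equiv.trans p (Equiv.sym ζ-κ))
    ; isSimpleQuotient = κ-regularEpi (Q i) , simple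
    }
    where
    open HomReasoning
    κQ = κ (Q i)
    -- One inclusion between `Q i` and `ker (At.q̄ i)` yields `m`; the opposite one, used below,
    -- makes it monic.
    factored : Σ _ λ m → At.q̄ i ≈ m ∘ κQ
    factored = κ-factor (Q i) (≤ker⇒identifies {R = Q i} {h = At.q̄ i} (At.Q≤ker i))
    m = proj₁ factored
    Fm-mono : Mono C (F₁ m)
    Fm-mono = preserves (κ-image-mono composable (Q i) (ker-q̄⊑Q i) (proj₂ factored))
    image : F₁ (At.q̄ i) ∘ ξ ≈ F₁ m ∘ (F₁ κQ ∘ ξ)
    image = begin
      F₁ (At.q̄ i) ∘ ξ       ≈⟨ ∘-resp-≈ˡ (F-resp-≈ (proj₂ factored)) ⟩
      F₁ (m ∘ κQ) ∘ ξ       ≈⟨ ∘-resp-≈ˡ homomorphism ⟩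
      (F₁ m ∘ F₁ κQ) ∘ ξ    ≈⟨ assoc ⟩
      F₁ m ∘ (F₁ κQ ∘ ξ)    ∎
    Q-identified : Identifies (Q i) (F₁ κQ ∘ ξ)
    Q-identified = Fm-mono _ _ (Equiv.trans (Equiv.sym assoc) (Equiv.trans
      (identifies-resp-≈ (Q i) image (≤ker⇒identifies {R = Q i} Q⊑P)) assoc))
    ζ = proj₁ (κ-factor (Q i) Q-identified)
    ζ-κ : ζ ∘ κQ ≈ F₁ κQ ∘ ξ
    ζ-κ = Equiv.sym (proj₂ (κ-factor (Q i) Q-identified))
    κ-morphism : CoalgebraMorphism H 𝒳 (X/ (Q i) ,ᶜ ζ)
    κ-morphism = record { hom = κQ ; commutes = ζ-κ }
    simple : Simple H (X/ (Q i) ,ᶜ ζ)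
    simple {𝒴} h rh = isIso-Coalg h (regularEpi-splitMono⇒IsIso rh
      (κ-epi (Q i) (Equiv.trans assoc
        (Equiv.trans (Equiv.sym (proj₂ retract)) (Equiv.sym identityˡ)))))
      where
      k : CoalgebraMorphism H 𝒳 𝒴
      k = Category._∘_ (Coalg H) h κ-morphism
      hom-k = CoalgebraMorphism.hom k
      rk : RegularEpi C hom-k
      rk = composable rh (κ-regularEpi (Q i))
      -- The composite of `h` with `κQ` is itself a coalgebra quotient of `𝒳`, so its kernel lies
      -- below `Q i` and `κQ` factors back through it. This gives `h` a left inverse.
      retract : Σ _ λ u → κQ ≈ u ∘ hom-k
      retract = regularEpi-factor rk
        (identifies-mono {R = ker hom-k} {S = Q i} (ker⊑Q k rk i) (Coeq.equality (Q i)))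

theorem4p20 : ∀ {o ℓ e} (C : Category o ℓ e)
    (fc : FinitelyComplete C) (coeq : HasCoequalizers C) →
    RegularEpisComposable C →
    (H : Endofunctor C) → PreservesMonos H →
    (select : Select C) → Progressing C select →
    (𝒳 : Coalgebra H) →
    FinitelyManyQuotients C (Coalgebra.carrier 𝒳) →
    let open PartitionRefinement fc coeq H select 𝒳 in
    Σ ℕ λ i → TerminatesAt i × ComputesSimpleQuotientAt i
theorem4p20 C fc coeq composable H preserves select progressing 𝒳 finite =
  let open Refinement fc coeq H select 𝒳
      i , terminated = terminates finite progressing
  in i , terminated ,
     Q⊑P⇒computesSimpleQuotient composable preserves i (proj₂ (proj₂ terminated))
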